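{- There is an absolute constant $c>0$ such that for all positive integers $r$ and $m$ and every integer $n \ge c\cdot 6^{rm}$ the following holds: if the points of $D(n)=\{0,1\}^n\times\{0,1\}^n$ are colored arbitrarily with $r$ colors, then there is a monochromatic binary tree with $m$ levels in $D(n)$.
   Context: Write $[n]=\{1,\dots,n\}$. For $I\subseteq[n]$, $\overline{I}=[n]\setminus I$ and $C=(c_j)_{j\in\overline I}\in\{0,1\}^{\overline I}$, the line $L(I,C)\subseteq D(n)$ is the set of all pairs $((x_1,\dots,x_n),(y_1,\dots,y_n))$ with $y_i=1-x_i$ for $i\in I$ and $x_j=y_j=c_j$ for $j\in\overline I$; it has $2^{|I|}$ points, and every point of $D(n)$ lies on exactly one line. A binary tree with $m$ levels in $D(n)$ is a family of points $P_v\in D(n)$ indexed by the binary words $v$ of length $0,1,\dots,m$ (the point $P_\emptyset$ is the root, and the points $P_v$ with $|v|=k$ form level $k$) such that: for every word $v$ of length less than $m$, if $P_v=(X,Y)$ then $P_{v0}=(X,Y_1)$ and $P_{v1}=(X_1,Y)$ for some $Y_1\in\{0,1\}^n$ and some $X_1\in\{0,1\}^n$ with $X_1\neq X$; and for each $k$ with $0\le k\le m$, all the $2^k$ points of level $k$ lie on a common line. (For $m=1$ this is a corner: three points $(X,Y),(X',Y),(X,Y')$ with $(X,Y')$ and $(X',Y)$ on a common line.) Monochromatic means all points of the family receive the same color. -}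

module Defs where

open import Data.Bool using (Bool; true; false; not; if_then_else_)
open import Data.Nat using (ℕ; _≤_; _<_)
open import Data.Fin using (Fin)
open import Data.Vec using (Vec; lookup)
open import Data.List using (List; length; _∷ʳ_)
open import Data.Product using (_×_; _,_; proj₁; proj₂; Σ)
open import Relation.Binary.PropositionalEquality using (_≡_; _≢_)

Point : ℕ → Set
Point n = Vec Bool n × Vec Bool n

-- Membership in the line L(I,C).  The subset I ⊆ [n] is given by its
-- characteristic vector; C is given as a vector on all of [n], of which
-- only the entries at j ∉ I are used (c_j for j ∈ Ī).
OnLine : {n : ℕ} → Vec Bool n → Vec Bool n → Point n → Set
OnLine {n} I C (X , Y) =
  (i : Fin n) →
    if lookup I i
    then lookup Y i ≡ not (lookup X i)
    else (lookup X i ≡ lookup C i × lookup Y i ≡ lookup C i)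

-- Binary words are lists of bits; v0 = v ∷ʳ false, v1 = v ∷ʳ true.
-- A family P indexed by all binary words; only words of length ≤ m matter.
IsBinaryTree : {n : ℕ} → (m : ℕ) → (List Bool → Point n) → Set
IsBinaryTree {n} m P =
  ((v : List Bool) → length v < m →
       (proj₁ (P (v ∷ʳ false)) ≡ proj₁ (P v))
     × (proj₂ (P (v ∷ʳ true)) ≡ proj₂ (P v))
     × (proj₁ (P (v ∷ʳ true)) ≢ proj₁ (P v)))
  ×
  ((k : ℕ) → k ≤ m →
     Σ (Vec Bool n) λ I → Σ (Vec Bool n) λ C →
       (v : List Bool) → length v ≡ k → OnLine I C (P v))

HasMonoTree : {n r : ℕ} → (m : ℕ) → (Point n → Fin r) → Set
HasMonoTree {n} {r} m χ =
  Σ (List Bool → Point n) λ P →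
    IsBinaryTree m P ×
    Σ (Fin r) λ col → (v : List Bool) → length v ≤ m → χ (P v) ≡ col

{-# OPTIONS --safe #-}
module Submission where

-- On a block of k coordinates with 2^k > R, two words x ≠ x′ are such that replacing one fully active
-- block by the other does not change a given R-valued colour; (x , ¬x′) on that block is then a parent
-- of the two points.  Recolouring the remaining coordinates by x, x′ and the colours of the children
-- and of the parent, and iterating r m times, gives a tree with r m levels in which every level is
-- monochromatic: the logarithm of the number of colours is multiplied by about 3 at each step, so
-- O(r 3^(rm)) ≤ O(6^(rm)) coordinates suffice.  Some colour occurs on m + 1 of its r m + 1 levels, and
-- skipping the other levels, by repeating letters, leaves a tree, as repeated left steps keep X and
-- repeated right steps keep Y.

open import Defs
open import Data.Nat using (ℕ; _≤_; _<_; _*_; _^_)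
open import Data.Fin using (Fin)
open import Data.Product using (Σ; _×_)
open import Data.Bool using (Bool; true; false; not; if_then_else_; T)
open import Data.Bool.Properties using (if-eta)
open import Data.Empty using (⊥-elim)
open import Data.Fin using (zero; suc; toℕ; fromℕ<; combine; finToFun; funToFin)
open import Data.Fin.Properties
  using (pigeonhole; combine-injective; funToFin-finToFin; 2↔Bool; any?; _≟_; toℕ<n; toℕ-fromℕ<)
  renaming (<⇒≢ to i<j⇒i≢j)
open import Data.List using (List; []; _∷_; _∷ʳ_; _++_; length; replicate)
open import Data.List.Properties using (length-++; length-replicate)
open import Data.Nat using (zero; suc; _+_; s≤s; z<s; _<ᵇ_; _<?_)
open import Data.Nat.Properties hiding (_≟_)
open import Data.Nat.Solver using (module +-*-Solver)
open import Data.Product using (_,_; proj₁; proj₂; ∃; ∃₂)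
open import Data.Sum using (_⊎_; inj₁; inj₂)
open import Data.Vec as Vec using (Vec; []; _∷_; lookup; map; zipWith; tabulate)
open import Data.Vec.Properties
  using (map-++; map-cong; ++-injectiveˡ; ++-injectiveʳ; lookup∘tabulate; lookup-map)
open import Function using (_∘_; _$_; id; Injective; Inverse; Injection)
open import Function.Properties.Inverse using (↔⇒↣)
open import Relation.Binary.PropositionalEquality
open import Relation.Nullary using (¬_; does; yes; no)
open import Relation.Nullary.Decidable using (dec-true)

-- Trees built from switched coordinates

infixr 5 _⊕_

_⊕_ : ∀ {k n} → Point k → Point n → Point (k + n)
(X , Y) ⊕ (X′ , Y′) = X Vec.++ X′ , Y Vec.++ Y′

-- The default `d` stands for letters not yet read: `false` in X and `true` in Y. So an unread
-- coordinate is (a , ¬b), and appending 0s keeps X while appending 1s keeps Y.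
bit : Bool → List Bool → ℕ → Bool
bit d []      _       = d
bit d (b ∷ _) zero    = b
bit d (_ ∷ v) (suc i) = bit d v i

bit-++-default : ∀ d v j i → bit d (v ++ replicate j d) i ≡ bit d v i
bit-++-default d []      zero    i       = refl
bit-++-default d []      (suc j) zero    = refl
bit-++-default d []      (suc j) (suc i) = bit-++-default d [] j i
bit-++-default d (b ∷ v) j       zero    = refl
bit-++-default d (b ∷ v) j       (suc i) = bit-++-default d v j i

bit-beyond : ∀ d v {i} → length v ≤ i → bit d v i ≡ d
bit-beyond d []      _        = refl
bit-beyond d (b ∷ v) (s≤s le) = bit-beyond d v le

bit-within : ∀ d d′ v {i} → i < length v → bit d v i ≡ bit d′ v i
bit-within d d′ (b ∷ v) {zero}  _        = refl
bit-within d d′ (b ∷ v) {suc i} (s≤s lt) = bit-within d d′ v lt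

bit-read : ∀ v {i} → (i <ᵇ length v) ≡ true → bit true v i ≡ bit false v i
bit-read v {i} eq = bit-within true false v (<ᵇ⇒< i _ (subst T (sym eq) _))

bit-unread : ∀ d v {i} → (i <ᵇ length v) ≡ false → bit d v i ≡ d
bit-unread d v eq = bit-beyond d v (≮⇒≥ (λ lt → subst T eq (<⇒<ᵇ lt)))

bit-middle : ∀ d u b v → bit d (u ++ b ∷ v) (length u) ≡ b
bit-middle d []      b v = refl
bit-middle d (_ ∷ u) b v = bit-middle d u b v

-- A coordinate (ℓ , a , b) is switched by the ℓ-th letter of the word: (a , ¬b) before that
-- letter is read, then (a , ¬a) after a 0 and (b , ¬b) after a 1.  It is active throughout if a = b.
Coord : Set
Coord = ℕ × Bool × Bool

left right : List Bool → Coord → Bool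
left  v (ℓ , a , b) = if bit false v ℓ then b else a
right v (ℓ , a , b) = not (if bit true v ℓ then b else a)

family : ∀ {n} → Vec Coord n → List Bool → Point n
family cs v = map (left v) cs , map (right v) cs

family-++-false : ∀ {n} (cs : Vec Coord n) v j →
  proj₁ (family cs (v ++ replicate j false)) ≡ proj₁ (family cs v)
family-++-false cs v j = map-cong
  (λ (ℓ , a , b) → cong (if_then b else a) (bit-++-default false v j ℓ)) cs

family-++-true : ∀ {n} (cs : Vec Coord n) v j →
  proj₂ (family cs (v ++ replicate j true)) ≡ proj₂ (family cs v)
family-++-true cs v j = map-cong
  (λ (ℓ , a , b) → cong (λ z → not (if z then b else a)) (bit-++-default true v j ℓ)) cs

-- If a ≠ b, an unread coordinate (a , ¬b) equals (a , a), hence is fixed with constant a; once read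
-- it is active. This depends on the word only through its length.
activeAt : ℕ → Coord → Bool
activeAt k (ℓ , true  , true)  = true
activeAt k (ℓ , false , false) = true
activeAt k (ℓ , _     , _)     = ℓ <ᵇ k

coord-on-line : ∀ v c →
  if activeAt (length v) c
  then right v c ≡ not (left v c)
  else (left v c ≡ proj₁ (proj₂ c) × right v c ≡ proj₁ (proj₂ c))
coord-on-line v (ℓ , true  , true)  =
  cong not (trans (if-eta (bit true v ℓ)) (sym (if-eta (bit false v ℓ))))
coord-on-line v (ℓ , false , false) =
  cong not (trans (if-eta (bit true v ℓ)) (sym (if-eta (bit false v ℓ))))
coord-on-line v (ℓ , true  , false) with ℓ <ᵇ length v in eq
... | true  = cong (λ z → not (if z then false else true)) (bit-read v eq)
... | false rewrite bit-unread true v eq | bit-unread false v eq = refl , refl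
coord-on-line v (ℓ , false , true)  with ℓ <ᵇ length v in eq
... | true  = cong (λ z → not (if z then true else false)) (bit-read v eq)
... | false rewrite bit-unread true v eq | bit-unread false v eq = refl , refl

family-on-line : ∀ {n} (cs : Vec Coord n) v →
  OnLine (map (activeAt (length v)) cs) (map (proj₁ ∘ proj₂) cs) (family cs v)
family-on-line cs v i
  rewrite lookup-map i (activeAt (length v)) cs
        | lookup-map i (proj₁ ∘ proj₂) cs
        | lookup-map i (left v) cs
        | lookup-map i (right v) cs = coord-on-line v (lookup cs i)

-- Supplies X₁ ≠ X at right children. The two words may have any lengths, because a tree edge will
-- later stand for several letters.
Separating : ∀ {n} → ℕ → Vec Coord n → Set
Separating M cs = ∀ i u v → i < M → bit false u i ≡ false → bit false v i ≡ true →
  proj₁ (family cs v) ≢ proj₁ (family cs u)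

-- Adding a block that branches last

mix : ∀ {k} → Vec Bool k → Vec Bool k → Point k
mix x x′ = x , map not x′

block : ∀ {k} → ℕ → Vec Bool k → Vec Bool k → Vec Coord k
block M = zipWith (λ a b → M , a , b)

map-left-block : ∀ {k} M (x x′ : Vec Bool k) v →
  map (left v) (block M x x′) ≡ (if bit false v M then x′ else x)
map-left-block M [] [] v = sym (if-eta (bit false v M))
map-left-block M (a ∷ x) (b ∷ x′) v rewrite map-left-block M x x′ v with bit false v M
... | true  = refl
... | false = refl

map-right-block : ∀ {k} M (x x′ : Vec Bool k) v →
  map (right v) (block M x x′) ≡ map not (if bit true v M then x′ else x)
map-right-block M [] [] v with bit true v M
... | true  = refl
... | false = refl
map-right-block M (a ∷ x) (b ∷ x′) v rewrite map-right-block M x x′ v with bit true v M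
... | true  = refl
... | false = refl

module _ {k n} (M : ℕ) (x x′ : Vec Bool k) (cs : Vec Coord n) where

  family-block : ∀ v → family (block M x x′ Vec.++ cs) v ≡
    mix (if bit false v M then x′ else x) (if bit true v M then x′ else x) ⊕ family cs v
  family-block v = cong₂ _,_
    (trans (map-++ (left v)  (block M x x′) cs) (cong (Vec._++ _) (map-left-block  M x x′ v)))
    (trans (map-++ (right v) (block M x x′) cs) (cong (Vec._++ _) (map-right-block M x x′ v)))

  family-block-inner : ∀ v → length v ≤ M →
    family (block M x x′ Vec.++ cs) v ≡ mix x x′ ⊕ family cs v
  family-block-inner v le = trans (family-block v)
    (cong₂ (λ b b′ → mix (if b then x′ else x) (if b′ then x′ else x) ⊕ family cs v)
      (bit-beyond false v le) (bit-beyond true v le))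

  -- Once letter `M` is read, X and Y select the same word, so the block is fully active with `x` or
  -- `x′`; the two equations cover these cases.
  family-block-leaf : ∀ {a} {A : Set a} (f : Point (k + n) → A) {θ} v → M < length v →
    f (mix x x ⊕ family cs v) ≡ θ → f (mix x′ x′ ⊕ family cs v) ≡ θ →
    f (family (block M x x′ Vec.++ cs) v) ≡ θ
  family-block-leaf f v lt eq eq′
    rewrite family-block v | bit-within true false v lt with bit false v M
  ... | true  = eq′
  ... | false = eq

  block-separating : x ≢ x′ → Separating M cs → Separating (suc M) (block M x x′ Vec.++ cs)
  block-separating x≢x′ sep i u v i<1+M ui vi same
    with m<1+n⇒m<n∨m≡n i<1+M
       | trans (sym (cong proj₁ (family-block v))) (trans same (cong proj₁ (family-block u)))
  ... | inj₁ i<M  | eq = sep i u v i<M ui vi (++-injectiveʳ _ _ eq)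
  ... | inj₂ refl | eq rewrite ui | vi = x≢x′ (sym (++-injectiveˡ _ _ eq))

-- Pigeonhole on the words of a block

funToFin-cong : ∀ {m n} {f g : Fin m → Fin n} → f ≗ g → funToFin f ≡ funToFin g
funToFin-cong {zero}  f≗g = refl
funToFin-cong {suc m} f≗g = cong₂ combine (f≗g zero) (funToFin-cong (f≗g ∘ suc))

word : ∀ k → Fin (2 ^ k) → Vec Bool k
word k i = tabulate (Inverse.to 2↔Bool ∘ finToFun i)

word-injective : ∀ k → Injective _≡_ _≡_ (word k)
word-injective k {i} {j} eq = trans (sym (funToFin-finToFin {k} {2} i))
  (trans (funToFin-cong bits≗) (funToFin-finToFin {k} {2} j))
  where
  bits≗ : finToFun {2} {k} i ≗ finToFun {2} {k} j
  bits≗ p = Injection.injective (↔⇒↣ 2↔Bool)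
    (trans (sym (lookup∘tabulate _ p)) (trans (cong (λ z → lookup z p) eq) (lookup∘tabulate _ p)))

module _ {r n : ℕ} (k : ℕ) {Θ : Set} (f : Point (k + n) → Θ) (χ : Θ → Point (k + n) → Fin r) where

  Refined : Set
  Refined = Θ × Fin (2 ^ k) × Fin (2 ^ k) × Fin r

  Refines : Point n → Refined → Set
  Refines Z (θ , i , j , c) =
      word k i ≢ word k j
    × f (mix (word k i) (word k i) ⊕ Z) ≡ θ
    × f (mix (word k j) (word k j) ⊕ Z) ≡ θ
    × χ θ (mix (word k i) (word k j) ⊕ Z) ≡ c

  -- The `2 ^ k` fully active words outnumber the codes, so two of them give `f` the same value.
  refine : ∀ {R} → R < 2 ^ k → (code : Θ → Fin R) → Injective _≡_ _≡_ code → (Z : Point n) → ∃ (Refines Z)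
  refine R<2^k code inj Z
    with i , j , i<j , eq ← pigeonhole R<2^k (λ i → code (f (mix (word k i) (word k i) ⊕ Z)))
    = (_ , i , j , _) , (i<j⇒i≢j i<j ∘ word-injective k) , refl , inj (sym eq) , refl

  refinedCode : ∀ {R} → (Θ → Fin R) → Refined → Fin (R * 2 ^ k * 2 ^ k * r)
  refinedCode code (θ , i , j , c) = combine (combine (combine (code θ) i) j) c

  refinedCode-injective : ∀ {R} {code : Θ → Fin R} → Injective _≡_ _≡_ code →
    Injective _≡_ _≡_ (refinedCode code)
  refinedCode-injective {code = code} inj {θ , i , j , c} {θ′ , i′ , j′ , c′} eq
    with eq₁ , refl ← combine-injective (combine (combine (code θ) i) j) c
                                        (combine (combine (code θ′) i′) j′) c′ eq
    with eq₂ , refl ← combine-injective (combine (code θ) i) j (combine (code θ′) i′) j′ eq₁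
    with eq₃ , refl ← combine-injective (code θ) i (code θ′) i′ eq₂
    with refl ← inj eq₃ = refl

-- Counting coordinates

-- `e` bounds the binary logarithm of the number of leaf values and is the size of the next block;
-- recording two words and a colour raises it to 3e + e₀.
need : ℕ → ℕ → ℕ → ℕ
need e₀ zero    e = 0
need e₀ (suc M) e = e + need e₀ M (e + e + e + e₀)

refined-bound : ∀ {R r e e₀} → R < 2 ^ e → r ≤ 2 ^ e₀ →
  R * 2 ^ e * 2 ^ e * r < 2 ^ (e + e + e + e₀)
refined-bound {R} {r} {e} {e₀} R<2^e r≤2^e₀ = begin-strict
  R * E * E * r          ≤⟨ *-monoʳ-≤ (R * E * E) r≤2^e₀ ⟩
  R * E * E * 2 ^ e₀     <⟨ *-monoˡ-< (2 ^ e₀) (*-monoˡ-< E (*-monoˡ-< E R<2^e)) ⟩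
  E * E * E * 2 ^ e₀     ≡⟨ cong (λ z → z * E * 2 ^ e₀) (^-distribˡ-+-* 2 e e) ⟨
  2 ^ (e + e) * E * 2 ^ e₀   ≡⟨ cong (_* 2 ^ e₀) (^-distribˡ-+-* 2 (e + e) e) ⟨
  2 ^ (e + e + e) * 2 ^ e₀   ≡⟨ ^-distribˡ-+-* 2 (e + e + e) e₀ ⟨
  2 ^ (e + e + e + e₀)   ∎
  where
  open ≤-Reasoning
  E = 2 ^ e
  instance
    _ = m^n≢0 2 e
    _ = m^n≢0 2 e₀

-- The summand `e` on the left absorbs the block just used, as e + e ≤ 3e + e₀, and each step at
-- most triples e + e₀.
need-bound : ∀ e₀ M e → need e₀ M e + e ≤ (e + e₀) * 3 ^ M
need-bound e₀ zero    e = ≤-trans (m≤m+n e e₀) (≤-reflexive (sym (*-identityʳ _)))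
need-bound e₀ (suc M) e = begin
  e + N + e                        ≤⟨ m≤m+n _ (e + e₀) ⟩
  e + N + e + (e + e₀)             ≡⟨ solve 3 (λ e N e₀ → e :+ N :+ e :+ (e :+ e₀) := N :+ (e :+ e :+ e :+ e₀)) refl e N e₀ ⟩
  N + (e + e + e + e₀)             ≤⟨ need-bound e₀ M (e + e + e + e₀) ⟩
  (e + e + e + e₀ + e₀) * 3 ^ M    ≤⟨ *-monoˡ-≤ (3 ^ M) (m≤m+n (e + e + e + e₀ + e₀) e₀) ⟩
  (e + e + e + e₀ + e₀ + e₀) * 3 ^ M ≡⟨ solve 3 (λ e e₀ t → (e :+ e :+ e :+ e₀ :+ e₀ :+ e₀) :* t := (e :+ e₀) :* (con 3 :* t)) refl e e₀ (3 ^ M) ⟩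
  (e + e₀) * (3 * 3 ^ M)           ∎
  where
  open ≤-Reasoning
  open +-*-Solver
  N = need e₀ M (e + e + e + e₀)

-- Making every level monochromatic

family-constant : ∀ {n} v → family (Vec.replicate n (0 , false , false)) v ≡
  family (Vec.replicate n (0 , false , false)) []
family-constant {zero}  v = refl
family-constant {suc n} v = cong₂ _,_
  (cong₂ _∷_ (if-eta (bit false v 0)) (cong proj₁ (family-constant v)))
  (cong₂ _∷_ (cong not (if-eta (bit true v 0))) (cong proj₂ (family-constant v)))

-- The levels above the leaves are coloured by χ θ, where θ is the value of f on the leaves.  This
-- dependence lets the induction remember, in θ, the block on which the last level branches.
level-monochromatic : ∀ {r e₀} → r ≤ 2 ^ e₀ → ∀ M {n R e} → R < 2 ^ e → need e₀ M e ≤ n →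
  {Θ : Set} (code : Θ → Fin R) → Injective _≡_ _≡_ code →
  (f : Point n → Θ) (χ : Θ → Point n → Fin r) →
  Σ (Vec Coord n) λ cs → Separating M cs × Σ Θ λ θ →
      (∀ v → M ≤ length v → f (family cs v) ≡ θ)
    × (∀ u v → length u ≡ length v → length u < M → χ θ (family cs u) ≡ χ θ (family cs v))
level-monochromatic r≤ zero R< _ code inj f χ =
  -- All coordinates are (0 , false , false), with a = b, so the family is a single point.
  _ , (λ _ _ _ ()) , _ , (λ v _ → cong f (family-constant v)) , (λ _ _ _ ())
level-monochromatic {r} {e₀} r≤ (suc M) {e = e} R< need≤n {Θ} code inj f χ
  with n , refl ← m≤n⇒∃[o]m+o≡n (≤-trans (m≤m+n e _) need≤n)
  with ref ← refine e f χ R< code inj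
  with cs , sep , (θ , i , j , c) , leaves , inner ←
    level-monochromatic r≤ M (refined-bound {e = e} R< r≤) (+-cancelˡ-≤ e _ _ need≤n)
      (refinedCode e f χ code) (refinedCode-injective e f χ inj)
      -- Words of length at most `M` show `mix x x′` on the new block, so inner points are coloured
      -- with that block inserted.
      (proj₁ ∘ ref) (λ (θ , i , j , _) Z → χ θ (mix (word e i) (word e j) ⊕ Z))
  = block M x x′ Vec.++ cs , block-separating M x x′ cs distinct sep , θ , leaves⁺ , inner⁺
  where
  x  = word e i
  x′ = word e j

  refines : ∀ v → M ≤ length v → Refines e f χ (family cs v) (θ , i , j , c)
  refines v le = subst (Refines e f χ (family cs v)) (leaves v le) (proj₂ (ref (family cs v)))

  distinct : x ≢ x′
  -- Any word of length `M` will do, since all leaves carry the same `i` and `j`.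
  distinct = proj₁ (refines (replicate M false) (≤-reflexive (sym (length-replicate M))))

  leaves⁺ : ∀ v → M < length v → f (family (block M x x′ Vec.++ cs) v) ≡ θ
  leaves⁺ v lt with _ , eq , eq′ , _ ← refines v (<⇒≤ lt) =
    family-block-leaf M x x′ cs f v lt eq eq′

  inner⁺ : ∀ u v → length u ≡ length v → length u < suc M →
    χ θ (family (block M x x′ Vec.++ cs) u) ≡ χ θ (family (block M x x′ Vec.++ cs) v)
  inner⁺ u v |u|≡|v| (s≤s |u|≤M) = trans
    (cong (χ θ) (family-block-inner M x x′ cs u |u|≤M))
    (trans (agree (m≤n⇒m<n∨m≡n |u|≤M))
      (sym (cong (χ θ) (family-block-inner M x x′ cs v (subst (_≤ M) |u|≡|v| |u|≤M)))))
    where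
    colour-at-M : ∀ w → M ≡ length w → χ θ (mix x x′ ⊕ family cs w) ≡ c
    colour-at-M w M≡ = proj₂ (proj₂ (proj₂ (refines w (≤-reflexive M≡))))

    agree : length u < M ⊎ length u ≡ M →
      χ θ (mix x x′ ⊕ family cs u) ≡ χ θ (mix x x′ ⊕ family cs v)
    agree (inj₁ |u|<M) = inner u v |u|≡|v| |u|<M
    -- Level `M` was the leaf level of the smaller family; the colour `c` of the new parents is
    -- recorded in its leaf value.
    agree (inj₂ |u|≡M) = trans (colour-at-M u (sym |u|≡M))
      (sym (colour-at-M v (trans (sym |u|≡M) |u|≡|v|)))

-- A colour on more than m of the r m + 1 levels

count : (ℕ → Bool) → ℕ → ℕ
count g zero    = 0
count g (suc t) = (if g 0 then 1 else 0) + count (g ∘ suc) t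

count-strict : ∀ g {i j} → i < j → g i ≡ true → count g i < count g j
count-strict g {zero}  {suc j} _         gi rewrite gi = z<s
count-strict g {suc i} {suc j} (s≤s i<j) gi =
  +-monoʳ-< (if g 0 then 1 else 0) (count-strict (g ∘ suc) i<j gi)

hasColour : ∀ {r} → (ℕ → Fin r) → Fin r → ℕ → Bool
hasColour col c k = does (col k ≟ c)

hasColour-complete : ∀ {r} (col : ℕ → Fin r) {c k} → col k ≡ c → hasColour col c k ≡ true
hasColour-complete col {c} {k} eq = dec-true (col k ≟ c) eq

hasColour-sound : ∀ {r} (col : ℕ → Fin r) {c k} → hasColour col c k ≡ true → col k ≡ c
hasColour-sound col {c} {k} eq with yes eq′ ← col k ≟ c = eq′

-- Otherwise (colour, number of earlier levels of that colour) sends r m + 1 levels to r m pairs,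
-- yet of two levels of one colour the later has the larger rank.
frequent-colour : ∀ {r} (col : ℕ → Fin r) m →
  ∃ λ c → m < count (hasColour col c) (suc (r * m))
frequent-colour {r} col m
  with any? (λ c → m <? count (hasColour col c) (suc (r * m)))
... | yes found = found
... | no  none  = ⊥-elim (clash (pigeonhole (n<1+n (r * m)) (λ i → combine (colour i) (rank i))))
  where
  before : ℕ → ℕ
  before k = count (hasColour col (col k)) k

  before-< : ∀ {k} → k ≤ r * m → before k < m
  before-< {k} k≤ = <-≤-trans
    (count-strict (hasColour col (col k)) (s≤s k≤) (hasColour-complete col refl))
    (≮⇒≥ (λ lt → none (col k , lt)))

  colour : Fin (suc (r * m)) → Fin r
  colour i = col (toℕ i)

  rank : Fin (suc (r * m)) → Fin m
  rank i = fromℕ< (before-< (≤-pred (toℕ<n i)))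

  clash : ¬ (∃₂ λ i j → toℕ i < toℕ j × combine (colour i) (rank i) ≡ combine (colour j) (rank j))
  clash (i , j , i<j , eq) with same , rank≡ ← combine-injective (colour i) (rank i) (colour j) (rank j) eq =
    <-irrefl (trans (sym (toℕ-fromℕ< _)) (trans (cong toℕ rank≡) (toℕ-fromℕ< _)))
      (subst (λ c → count (hasColour col c) (toℕ i) < before (toℕ j)) (sym same)
        (count-strict (hasColour col (colour j)) i<j (hasColour-complete col same)))

-- Skipping the levels of other colours

-- Levels 0, …, t − 1 are good where g is true.  The word v is stretched so that it walks along good
-- levels only: at a bad level the last letter read (initially b) is repeated.
stretch : (ℕ → Bool) → ℕ → Bool → List Bool → List Bool
stretch g zero    b v = []
stretch g (suc t) b v with g 0 | v
... | false | v′     = b ∷ stretch (g ∘ suc) t b v′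
... | true  | []     = []
... | true  | d ∷ v′ = d ∷ stretch (g ∘ suc) t d v′

-- Which levels are skipped depends on `g` alone, so a level of the subtree lies within one level of
-- the large tree.
stretch-length : ∀ g t b b′ u v → length u ≡ length v →
  length (stretch g t b u) ≡ length (stretch g t b′ v)
stretch-length g zero    b b′ u v eq = refl
stretch-length g (suc t) b b′ u v eq with g 0 | u | v | eq
... | false | u′     | v′      | e = cong suc (stretch-length (g ∘ suc) t b b′ u′ v′ e)
... | true  | []     | []      | _ = refl
... | true  | d ∷ u′ | d′ ∷ v′ | e =
  cong suc (stretch-length (g ∘ suc) t d d′ u′ v′ (suc-injective e))

-- With fewer letters than good levels the recursion ends for lack of letters, and that happens only
-- at a good level.
stretch-good : ∀ g t b v → length v < count g t →
  length (stretch g t b v) < t × g (length (stretch g t b v)) ≡ true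
stretch-good g (suc t) b v lt with g 0 in g0 | v
... | false | v′ with p , q ← stretch-good (g ∘ suc) t b v′ lt = s≤s p , q
... | true  | [] = z<s , g0
... | true  | d ∷ v′ with p , q ← stretch-good (g ∘ suc) t d v′ (≤-pred lt) = s≤s p , q

stretch-[] : ∀ g t b → ∃ λ j → stretch g t b [] ≡ replicate j b
stretch-[] g zero    b = 0 , refl
stretch-[] g (suc t) b with g 0
... | true  = 0 , refl
... | false with j , eq ← stretch-[] (g ∘ suc) t b = suc j , cong (b ∷_) eq

-- `v` stops at a good level, where `d` is read, and the bad levels after it repeat `d`. So an edge
-- is a run of equal letters, which keeps X or Y.
stretch-∷ʳ : ∀ g t b v d → length v < count g t →
  ∃ λ j → stretch g t b (v ∷ʳ d) ≡ stretch g t b v ++ replicate (suc j) d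
stretch-∷ʳ g (suc t) b v d lt with g 0 | v
... | false | v′ with j , eq ← stretch-∷ʳ (g ∘ suc) t b v′ d lt = j , cong (b ∷_) eq
... | true  | [] with j , eq ← stretch-[] (g ∘ suc) t d = j , cong (d ∷_) eq
... | true  | b′ ∷ v′ with j , eq ← stretch-∷ʳ (g ∘ suc) t b′ v′ d (≤-pred lt) = j , cong (b′ ∷_) eq

mono-subtree : ∀ {n r m} (χ : Point n → Fin r) (cs : Vec Coord n) → Separating (r * m) cs →
  (∀ u v → length u ≡ length v → length u ≤ r * m → χ (family cs u) ≡ χ (family cs v)) →
  HasMonoTree m χ
mono-subtree {n} {r} {m} χ cs sep level
  with c , m<count ← frequent-colour (λ k → χ (family cs (replicate k false))) m
  = family cs ∘ σ , (edges , lines) , c , mono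
  where
  col : ℕ → Fin r
  col k = χ (family cs (replicate k false))

  g : ℕ → Bool
  g = hasColour col c

  σ : List Bool → List Bool
  σ = stretch g (suc (r * m)) false

  σ-∷ʳ : ∀ v d → length v < m → ∃ λ j → σ (v ∷ʳ d) ≡ σ v ++ replicate (suc j) d
  σ-∷ʳ v d lt = stretch-∷ʳ g _ false v d (<-trans lt m<count)

  edges : ∀ v → length v < m →
      (proj₁ (family cs (σ (v ∷ʳ false))) ≡ proj₁ (family cs (σ v)))
    × (proj₂ (family cs (σ (v ∷ʳ true))) ≡ proj₂ (family cs (σ v)))
    × (proj₁ (family cs (σ (v ∷ʳ true))) ≢ proj₁ (family cs (σ v)))
  edges v lt
    with j₀ , eq₀ ← σ-∷ʳ v false lt | j₁ , eq₁ ← σ-∷ʳ v true lt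
    = trans (cong (proj₁ ∘ family cs) eq₀) (family-++-false cs (σ v) (suc j₀))
    , trans (cong (proj₂ ∘ family cs) eq₁) (family-++-true cs (σ v) (suc j₁))
    -- Position `length (σ v)` lies beyond `σ v`, where X takes the default `false`, and holds
    -- `true` in the right child.
    , sep (length (σ v)) (σ v) (σ (v ∷ʳ true)) |σv|<rm (bit-beyond false (σ v) ≤-refl)
        (trans (cong (λ u → bit false u _) eq₁) (bit-middle false (σ v) true _))
    where
    |σv|<rm : length (σ v) < r * m
    -- The child is strictly longer and still ends on a level up to `r * m`.
    |σv|<rm with j , eq ← σ-∷ʳ v true lt = ≤-pred $ begin-strict
      suc (length (σ v))                          ≤⟨ s≤s (m≤m+n _ j) ⟩
      suc (length (σ v) + j)                      ≡⟨ +-suc _ j ⟨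
      length (σ v) + suc j                        ≡⟨ cong (λ z → length (σ v) + suc z) (length-replicate j) ⟨
      length (σ v) + length (replicate (suc j) true) ≡⟨ length-++ (σ v) ⟨
      length (σ v ++ replicate (suc j) true)      ≡⟨ cong length eq ⟨
      length (σ (v ∷ʳ true))                      <⟨ proj₁ (stretch-good g _ false (v ∷ʳ true) |v∷ʳ|<) ⟩
      suc (r * m)                                 ∎
      where
      open ≤-Reasoning
      |v∷ʳ|< : length (v ∷ʳ true) < count g (suc (r * m))
      |v∷ʳ|< = ≤-<-trans (≤-trans (≤-reflexive (trans (length-++ v) (+-comm _ 1))) lt) m<count

  lines : ∀ k → k ≤ m → Σ (Vec Bool n) λ I → Σ (Vec Bool n) λ C →
    ∀ v → length v ≡ k → OnLine I C (family cs (σ v))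
  lines k _ = map (activeAt (length (σ (replicate k false)))) cs , map (proj₁ ∘ proj₂) cs , λ v |v|≡k →
    subst (λ l → OnLine (map (activeAt l) cs) (map (proj₁ ∘ proj₂) cs) (family cs (σ v)))
      (stretch-length g (suc (r * m)) false false v (replicate k false) (trans |v|≡k (sym (length-replicate k))))
      (family-on-line cs (σ v))

  mono : ∀ v → length v ≤ m → χ (family cs (σ v)) ≡ c
  mono v le with |σv|<t , good ← stretch-good g _ false v (≤-<-trans le m<count) = trans
    (level (σ v) (replicate (length (σ v)) false) (sym (length-replicate _)) (≤-pred |σv|<t))
    (hasColour-sound col {k = length (σ v)} good)

-- The constant and the conclusion

n<2^n : ∀ n → n < 2 ^ n
n<2^n zero    = z<s
n<2^n (suc n) = begin
  suc (suc n)     ≤⟨ s≤s (n<2^n n) ⟩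
  1 + 2 ^ n       ≤⟨ +-mono-≤ (m^n>0 2 n) (m≤m+n (2 ^ n) 0) ⟩
  2 ^ suc n       ∎
  where open ≤-Reasoning

-- With e = e₀ = r the bound is 2 r 3^M for M = r m, and r ≤ r m < 2^M.
need-≤-6^ : ∀ r m → 0 < m → need r (r * m) r ≤ 2 * 6 ^ (r * m)
need-≤-6^ r m@(suc _) _ = begin
  need r M r                ≤⟨ m≤m+n _ r ⟩
  need r M r + r            ≤⟨ need-bound r M r ⟩
  (r + r) * 3 ^ M           ≡⟨ solve 2 (λ r t → (r :+ r) :* t := con 2 :* (r :* t)) refl r (3 ^ M) ⟩
  2 * (r * 3 ^ M)           ≤⟨ *-monoʳ-≤ 2 (*-monoˡ-≤ (3 ^ M) (≤-trans (m≤m*n r m) (<⇒≤ (n<2^n M)))) ⟩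
  2 * (2 ^ M * 3 ^ M)       ≡⟨ cong (2 *_) (^-distribʳ-* 2 3 M) ⟨
  2 * 6 ^ M                 ∎
  where
  open ≤-Reasoning
  open +-*-Solver
  M = r * m
  ^-distribʳ-* : ∀ a b k → (a * b) ^ k ≡ a ^ k * b ^ k
  ^-distribʳ-* a b zero    = refl
  ^-distribʳ-* a b (suc k) rewrite ^-distribʳ-* a b k =
    solve 4 (λ a b x y → a :* b :* (x :* y) := a :* x :* (b :* y)) refl a b (a ^ k) (b ^ k)

levels-monochromatic : ∀ {n r M} {χ : Point n → Fin r} {cs : Vec Coord n} {θ} →
  (∀ v → M ≤ length v → χ (family cs v) ≡ θ) →
  (∀ u v → length u ≡ length v → length u < M → χ (family cs u) ≡ χ (family cs v)) →
  ∀ u v → length u ≡ length v → length u ≤ M → χ (family cs u) ≡ χ (family cs v)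
levels-monochromatic leaves inner u v eq le with m≤n⇒m<n∨m≡n le
... | inj₁ lt   = inner u v eq lt
... | inj₂ refl = trans (leaves u ≤-refl) (sym (leaves v (≤-reflexive eq)))

theorem1 : Σ ℕ λ c → 0 < c ×
    ((r m n : ℕ) → 0 < r → 0 < m → c * 6 ^ (r * m) ≤ n →
    (χ : Point n → Fin r) → HasMonoTree m χ)
theorem1 = 2 , z<s , λ r m n _ 0<m bound χ →
  let cs , sep , _ , leaves , inner =
        -- As r < 2^r, both exponents can be `r`; leaf values are the colours themselves.
        level-monochromatic (<⇒≤ (n<2^n r)) (r * m) (n<2^n r)
          (≤-trans (need-≤-6^ r m 0<m) bound) id id χ (λ _ → χ)
  in mono-subtree χ cs sep (levels-monochromatic {χ = χ} leaves inner)
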